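{- Let $T=(V,E)$ be a tree with $n\ge 5$ vertices and let $\{x_1,\dots,x_k\}\subseteq V$ be a set of $k$ (pairwise distinct) vertices of $T$, where $k$ is an integer. Then $T$ is $(-k)$-critical with $\sigma(T)=\{x_1,\dots,x_k\}$ if and only if the following four assertions all hold: 1. For all $x\neq y$ in $\mathcal{L}(T)$, $dist(x,y)\geq 3$. 2. $\{x_1,\dots,x_k\}\subseteq \mathcal{L}(T)$ and $1\le k\le \lfloor \frac{n}{2}\rfloor$. 3. For each $x\in \mathcal{L}(T)\setminus\{x_1,\dots,x_k\}$, there is a unique $i\in\{1,\dots,k\}$ such that $dist(x,x_i)=3$ and $d(x^+)=2$. 4. For each $i\in\{1,\dots,k\}$, if $d(x_i^+)=2$, then for all $x\in\mathcal{L}(T)\setminus\{x_i\}$, $dist(x_i,x)\ge 4$.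
   Context: Graphs are finite, simple and undirected. For a graph $G=(V,E)$, a module of $G$ is a subset $M\subseteq V$ such that every vertex outside $M$ is adjacent to all or to none of the vertices of $M$. The modules $\emptyset$, $\{x\}$ ($x\in V$) and $V$ are trivial. $G$ is indecomposable if all its modules are trivial, and decomposable otherwise; $G$ is prime if it is indecomposable and has at least four vertices. For $x\in V$, $G-x$ is the subgraph induced on $V\setminus\{x\}$. A vertex $x$ of a prime graph $G$ is critical if $G-x$ is decomposable, and non-critical otherwise; $\sigma(G)$ denotes the set of non-critical vertices of $G$. A prime graph with exactly $k$ non-critical vertices is called $(-k)$-critical. $d(x)$ is the degree of $x$; $dist(x,y)$ is the number of edges of a shortest path between $x$ and $y$. A leaf is a vertex of degree one; $\mathcal{L}(T)$ is the set of leaves of $T$. For a leaf $x$, $x^+$ denotes its unique neighbor. -}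

module Defs where

open import Data.Bool.Properties as Bool using ()
open import Data.Fin using (Fin; zero; suc; punchIn)
open import Data.Fin.Properties using (_≟_; all?; any?)
open import Data.Fin.Subset using (Subset; inside; outside; _∈_; _∉_; ⊥; ⊤; ⁅_⁆; ∣_∣)
open import Data.Fin.Subset.Properties using (_∈?_; anySubset?)
open import Data.List using (List; []; _∷_)
open import Data.List.Relation.Unary.Unique.DecPropositional using (unique?)
open import Data.List.Relation.Unary.Unique.Propositional using (Unique)
open import Data.Nat as ℕ using (ℕ; zero; suc; pred; _≤_; z≤n; s≤s)
open import Data.Nat.Properties using (suc-injective)
open import Data.Product using (∃; ∃!; _×_; _,_; proj₁)
open import Data.Sum using (_⊎_)
open import Data.Vec as Vec using (_∷_)
open import Data.Vec.Properties using (≡-dec; []=⇒lookup; lookup⇒[]=; lookup∘tabulate)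
open import Function using (_∘_; _⇔_; mk⇔; Equivalence)
open import Level using (0ℓ)
open import Relation.Binary using (Rel; Symmetric; Irreflexive; DecidableEquality)
  renaming (Decidable to Decidable₂)
open import Relation.Binary.Construct.Closure.ReflexiveTransitive using (Star; ε; _◅_)
open import Relation.Binary.PropositionalEquality
  using (_≡_; refl; sym; trans; cong)
open import Relation.Nullary using (¬_; Dec; yes; no; does; contradiction)
open import Relation.Nullary.Decidable
  using (map′; _×-dec_; _⊎-dec_; _→-dec_; ¬?; dec-true; decidable-stable)
open import Relation.Unary using (Pred; Decidable)

private variable
  n k : ℕ

⟪_⟫ : {P : Pred (Fin n) 0ℓ} → Decidable P → Subset n
⟪ P? ⟫ = Vec.tabulate (does ∘ P?)

∈⟪⟫ : {P : Pred (Fin n) 0ℓ} (P? : Decidable P) {x : Fin n} → x ∈ ⟪ P? ⟫ ⇔ P x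
∈⟪⟫ {P = P} P? {x} = mk⇔ to from
  where
  to : x ∈ ⟪ P? ⟫ → P x
  to x∈ with P? x | trans (sym (lookup∘tabulate (does ∘ P?) x)) ([]=⇒lookup x∈)
  ... | yes p | _ = p
  ... | no _  | ()

  from : P x → x ∈ ⟪ P? ⟫
  from p = lookup⇒[]= x _ (trans (lookup∘tabulate (does ∘ P?) x) (dec-true (P? x) p))

range? : (x : Fin k → Fin n) → Decidable (λ v → ∃ λ i → x i ≡ v)
range? x v = any? λ i → x i ≟ v

-- The set {x₁, …, x_k}.
range : (Fin k → Fin n) → Subset n
range x = ⟪ range? x ⟫

∣p∣≡0⇒∉ : (p : Subset n) → ∣ p ∣ ≡ 0 → ∀ {y} → y ∉ p
∣p∣≡0⇒∉ (outside ∷ p) eq (Vec.there y∈p) = ∣p∣≡0⇒∉ p eq y∈p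
∣p∣≡0⇒∉ (inside ∷ p) ()

∣p∣≡1⇒∃! : (p : Subset n) → ∣ p ∣ ≡ 1 → ∃! _≡_ (_∈ p)
∣p∣≡1⇒∃! (inside ∷ p) eq = zero , Vec.here , unique
  where
  unique : ∀ {y} → y ∈ inside ∷ p → zero ≡ y
  unique Vec.here        = refl
  unique (Vec.there y∈p) = contradiction y∈p (∣p∣≡0⇒∉ p (suc-injective eq))
∣p∣≡1⇒∃! (outside ∷ p) eq with ∣p∣≡1⇒∃! p eq
... | x , x∈p , unique = suc x , Vec.there x∈p , λ { (Vec.there y∈p) → cong suc (unique y∈p) }

record Graph (n : ℕ) : Set₁ where
  field
    Adj        : Rel (Fin n) 0ℓ
    adj?       : Decidable₂ Adj
    Adj-sym    : Symmetric Adj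
    Adj-irrefl : Irreflexive _≡_ Adj

open Graph

-- The subgraph induced on V ∖ {x}; its n - 1 vertices are renumbered along
-- the order-preserving bijection punchIn x : Fin (n - 1) → Fin n ∖ {x}.
_∖_ : Graph n → Fin n → Graph (pred n)
_∖_ {suc n} G x = record
  { Adj        = λ u v → Adj G (punchIn x u) (punchIn x v)
  ; adj?       = λ u v → adj? G (punchIn x u) (punchIn x v)
  ; Adj-sym    = Adj-sym G
  ; Adj-irrefl = λ u≡v → Adj-irrefl G (cong (punchIn x) u≡v)
  }

neighbours : Graph n → Fin n → Subset n
neighbours G x = ⟪ adj? G x ⟫

degree : Graph n → Fin n → ℕ
degree G x = ∣ neighbours G x ∣

degree≟1 : (G : Graph n) → Decidable (λ x → degree G x ≡ 1)
degree≟1 G x = degree G x ℕ.≟ 1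

𝓛 : Graph n → Subset n
𝓛 G = ⟪ degree≟1 G ⟫

leaf-neighbour : (G : Graph n) {x : Fin n} → x ∈ 𝓛 G → ∃! _≡_ (Adj G x)
leaf-neighbour G {x} x∈𝓛
  with ∣p∣≡1⇒∃! (neighbours G x) (Equivalence.to (∈⟪⟫ (degree≟1 G)) x∈𝓛)
... | y , y∈N , unique =
  y , Equivalence.to (∈⟪⟫ (adj? G x)) y∈N , unique ∘ Equivalence.from (∈⟪⟫ (adj? G x))

-- The vertex written x⁺ for a leaf x.
_⟨_⟩⁺ : (G : Graph n) {x : Fin n} → x ∈ 𝓛 G → Fin n
G ⟨ x∈𝓛 ⟩⁺ = proj₁ (leaf-neighbour G x∈𝓛)

IsModule : Graph n → Subset n → Set
IsModule G M = ∀ v → v ∉ M →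
  (∀ u → u ∈ M → Adj G v u) ⊎ (∀ u → u ∈ M → ¬ Adj G v u)

IsTrivial : Subset n → Set
IsTrivial M = M ≡ ⊥ ⊎ (∃ λ x → M ≡ ⁅ x ⁆) ⊎ M ≡ ⊤

Indecomposable : Graph n → Set
Indecomposable G = ∀ M → IsModule G M → IsTrivial M

Decomposable : Graph n → Set
Decomposable G = ¬ Indecomposable G

Prime : Graph n → Set
Prime {n} G = Indecomposable G × 4 ≤ n

Critical : Graph n → Fin n → Set
Critical G x = Decomposable (G ∖ x)

NonCritical : Graph n → Fin n → Set
NonCritical G x = ¬ Critical G x

isModule? : (G : Graph n) → Decidable (IsModule G)
isModule? G M = all? λ v → ¬? (v ∈? M) →-dec
  (all? (λ u → (u ∈? M) →-dec adj? G v u) ⊎-dec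
   all? (λ u → (u ∈? M) →-dec ¬? (adj? G v u)))

_≟ˢ_ : DecidableEquality (Subset n)
_≟ˢ_ = ≡-dec Bool._≟_

isTrivial? : Decidable (IsTrivial {n})
isTrivial? M = (M ≟ˢ ⊥) ⊎-dec (any? (λ x → M ≟ˢ ⁅ x ⁆) ⊎-dec (M ≟ˢ ⊤))

indecomposable? : (G : Graph n) → Dec (Indecomposable G)
indecomposable? G =
  map′ (λ none M mod → decidable-stable (isTrivial? M) λ nontriv → none (M , mod , nontriv))
       (λ indec (M , mod , nontriv) → nontriv (indec M mod))
       (¬? (anySubset? (λ M → isModule? G M ×-dec ¬? (isTrivial? M))))

critical? : (G : Graph n) → Decidable (Critical G)
critical? G x = ¬? (indecomposable? (G ∖ x))

nonCritical? : (G : Graph n) → Decidable (NonCritical G)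
nonCritical? G x = ¬? (critical? G x)

σ : Graph n → Subset n
σ G = ⟪ nonCritical? G ⟫

[-_]-Critical : ℕ → Graph n → Set
[- k ]-Critical G = Prime G × ∣ σ G ∣ ≡ k

module _ {A : Set} {T : Rel A 0ℓ} where

  vertices : ∀ {u v} → Star T u v → List A
  vertices {u} ε       = u ∷ []
  vertices {u} (_ ◅ w) = u ∷ vertices w

  edges : ∀ {u v} → Star T u v → ℕ
  edges ε       = 0
  edges (_ ◅ w) = suc (edges w)

record Path (G : Graph n) (u v : Fin n) : Set where
  constructor path
  field
    walk   : Star (Adj G) u v
    simple : Unique (vertices walk)

  length : ℕ
  length = edges walk

open Path

Connected : Graph n → Set
Connected G = ∀ u v → Path G u v

-- A cycle is a path u … v with at least two edges, closed by an edge v u.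
Acyclic : Graph n → Set
Acyclic G = ∀ {u v} (p : Path G u v) → 2 ≤ length p → ¬ Adj G v u

record IsTree (G : Graph n) : Set where
  field
    connected : Connected G
    acyclic   : Acyclic G

Shortest : {G : Graph n} {u v : Fin n} → Path G u v → Set
Shortest {G = G} {u} {v} p = (q : Path G u v) → length p ≤ length q

walkOfLength? : (G : Graph n) {Q : Pred (List (Fin n)) 0ℓ} → Decidable Q →
  ∀ ℓ u v → Dec (∃ λ (w : Star (Adj G) u v) → edges w ≡ ℓ × Q (vertices w))
walkOfLength? G Q? zero u v with u ≟ v
... | no u≢v   = no λ { (ε , _) → u≢v refl ; (_ ◅ _ , () , _) }
... | yes refl = map′ (λ q → ε , refl , q)
                      (λ { (ε , _ , q) → q ; (_ ◅ _ , () , _) })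
                      (Q? (u ∷ []))
walkOfLength? G Q? (suc ℓ) u v =
  map′ (λ { (x , a , w , eq , q) → a ◅ w , cong suc eq , q })
       (λ { (ε , () , _) ; (a ◅ w , eq , q) → _ , a , w , suc-injective eq , q })
       (any? λ x → adj? G u x ×-dec walkOfLength? G (Q? ∘ (u ∷_)) ℓ x v)

least : {P : Pred ℕ 0ℓ} → Decidable P → ∀ m → P m → ∃ λ d → P d × (∀ j → P j → d ≤ j)
least P? m pm with P? 0
least P? m       pm | yes p₀ = 0 , p₀ , λ _ _ → z≤n
least P? zero    pm | no ¬p₀ = contradiction pm ¬p₀
least P? (suc m) pm | no ¬p₀ with least (P? ∘ suc) m pm
... | d , pd , min =
  suc d , pd , λ { zero p₀ → contradiction p₀ ¬p₀ ; (suc j) pj → s≤s (min j pj) }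

shortestPath : (G : Graph n) → Connected G → ∀ u v → ∃ λ (p : Path G u v) → Shortest p
shortestPath G conn u v
  with least (λ ℓ → walkOfLength? G (unique? _≟_) ℓ u v) (length p₀) (walk p₀ , refl , simple p₀)
  where p₀ = conn u v
... | _ , (w , refl , uniq) , min =
  path w uniq , λ q → min (length q) (walk q , refl , simple q)

dist : (G : Graph n) → Connected G → Fin n → Fin n → ℕ
dist G conn u v = length (proj₁ (shortestPath G conn u v))

{-# OPTIONS --safe #-}
module Submission where

-- A nontrivial module of a tree is a set of leaves with a common neighbour, because a connected
-- graph without triangles and squares leaves no other possibility; so a tree is indecomposable
-- iff it has no twin leaves.  Deleting an inner vertex disconnects the tree and hence makes a
-- prime tree decomposable.  Deleting a leaf x leaves a tree, whose only new leaf can be x⁺; so x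
-- is critical iff d(x⁺) = 2 and some leaf y "blocks" it, hanging on the other neighbour of x⁺,
-- i.e. dist(x,y) = 3.  Such a y is unique, and it is not critical itself since otherwise the tree
-- would be a path on four vertices.  The bound k ≤ n/2 holds because x₁, …, x_k, x₁⁺, …, x_k⁺ are
-- pairwise distinct.

open import Defs
open import Data.Fin using (Fin; zero; suc; punchIn; punchOut; splitAt; join)
open import Data.Fin.Properties
  using (_≟_; all?; any?; suc-injective; injective⇒≤; sequence; punchInᵢ≢i; punchIn-injective;
         punchIn-punchOut; punchOut-punchIn; punchOut-cong; join-splitAt)
open import Data.Fin.Subset using (Subset; inside; outside; _∈_; _∉_; _⊆_; ⁅_⁆; ∣_∣; ∁; _∪_)
open import Data.Fin.Subset.Properties
  using (_∈?_; nonempty?; ⊆-antisym; ∉⊥; ∈⊤; Empty-unique; x∈⁅x⁆; x∈⁅y⁆⇒x≡y; x∈p∪q⁺; x∈p∪q⁻;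
         x∈p⇒x∉∁p; x∈∁p⇒x∉p; x∉p⇒x∈∁p; x∉∁p⇒x∈p)
open import Data.List as List using (List; []; _∷_)
open import Data.List.Membership.Propositional using () renaming (_∈_ to _∈ˡ_; _∉_ to _∉ˡ_)
open import Data.List.Membership.DecPropositional using () renaming (_∈?_ to ∈ˡ?)
open import Data.List.Membership.Propositional.Properties using (∈-lookup; ∈-map⁻)
open import Data.List.Relation.Unary.All as All using ([]; _∷_)
open import Data.List.Relation.Unary.All.Properties using (¬Any⇒All¬; All¬⇒¬Any; anti-mono)
open import Data.List.Relation.Unary.Any using (here; there)
open import Data.List.Relation.Unary.AllPairs using ([]; _∷_)
open import Data.List.Relation.Unary.Unique.Propositional using (Unique)
import Data.List.Relation.Unary.Unique.Propositional.Properties as Uniqueₚ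
import Data.List.Relation.Binary.Subset.Propositional as List⊆
open import Data.Nat as ℕ using (ℕ; zero; suc; _≤_; _≥_; ⌊_/2⌋; z≤n; s≤s; s≤s⁻¹)
open import Data.Nat.Properties
  using (≤-antisym; ≤-trans; ≤-reflexive; 1+n≰n; ≤∧≢⇒<; ⌊n/2⌋-mono; n≡⌊n+n/2⌋)
open import Data.Product using (∃; ∃₂; ∃!; _×_; _,_; proj₁; proj₂)
open import Data.Sum using (_⊎_; inj₁; inj₂; [_,_]′)
open import Data.Vec as Vec using ([]; _∷_; lookup)
open import Effect.Monad using (RawMonad)
open import Function using (_∘_; _⇔_; mk⇔; Equivalence; Injective; id)
open import Level using (0ℓ)
open import Relation.Binary using (Rel)
open import Relation.Binary.Construct.Closure.ReflexiveTransitive using (Star; ε; _◅_; _◅◅_; gmap)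
open import Relation.Binary.PropositionalEquality
  using (_≡_; _≢_; refl; sym; trans; cong; subst; subst₂; ≢-sym)
open import Relation.Nullary using (¬_; Dec; yes; no; contradiction)
open import Relation.Nullary.Decidable
  using (_×-dec_; ¬?; decidable-stable; ¬¬-excluded-middle)
open import Relation.Nullary.Negation using (¬¬-Monad)
open import Relation.Unary using (Pred; Decidable)

open Equivalence using (to; from)
open Graph
open Path

private variable
  m n k l : ℕ
  A : Set

-- Counting finite sets by enumerations.

-- The chosen preimages under `g` are distinct because `f` is injective. With `f = id` this bounds
-- the number of vertices by the length of a list that covers them.
cover⇒≤ : {f : Fin k → A} (g : Fin l → A) → Injective _≡_ _≡_ f →
  (∀ i → ∃ λ j → g j ≡ f i) → k ≤ l
cover⇒≤ g inj c = injective⇒≤ {f = proj₁ ∘ c} λ {i} {j} eq →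
  inj (trans (sym (proj₂ (c i))) (trans (cong g eq) (proj₂ (c j))))

Enumerates : (Fin k → Fin n) → Subset n → Set
Enumerates e p = Injective _≡_ _≡_ e × (∀ {v} → v ∈ p ⇔ ∃ λ i → e i ≡ v)

enumerate : (p : Subset n) → ∃ λ (e : Fin ∣ p ∣ → Fin n) → Enumerates e p
enumerate [] = (λ ()) , (λ { {()} }) , mk⇔ (λ ()) (λ ())
enumerate (outside ∷ p) with enumerate p
... | e , inj , onto = suc ∘ e , inj ∘ suc-injective , mk⇔
  (λ { (Vec.there v∈p) → let i , eq = to onto v∈p in i , cong suc eq })
  (λ { (i , refl) → Vec.there (from onto (i , refl)) })
enumerate {suc n} (inside ∷ p) with enumerate p
... | e , inj , onto = e′ , inj′ , mk⇔
  (λ { Vec.here → zero , refl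
     ; (Vec.there v∈p) → let i , eq = to onto v∈p in suc i , cong suc eq })
  (λ { (zero , refl) → Vec.here
     ; (suc i , refl) → Vec.there (from onto (i , refl)) })
  where
  e′ : Fin (suc ∣ p ∣) → Fin (suc n)
  e′ zero    = zero
  e′ (suc i) = suc (e i)

  inj′ : Injective _≡_ _≡_ e′
  inj′ {zero}  {zero}  _  = refl
  inj′ {suc i} {suc j} eq = cong suc (inj (suc-injective eq))

enumerates⇒∣p∣≡ : {e : Fin k → Fin n} {p : Subset n} → Enumerates e p → ∣ p ∣ ≡ k
enumerates⇒∣p∣≡ {e = e} {p} (inj , onto) with enumerate p
... | e′ , inj′ , onto′ = ≤-antisym
  (cover⇒≤ e inj′ λ i → to onto (from onto′ (i , refl)))
  (cover⇒≤ e′ inj λ i → to onto′ (from onto (i , refl)))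

∣range∣ : {x : Fin k → Fin n} → Injective _≡_ _≡_ x → ∣ range x ∣ ≡ k
∣range∣ {x = x} inj = enumerates⇒∣p∣≡ (inj , ∈⟪⟫ (range? x))

unique⇒lookup-injective : {xs : List A} → Unique xs → Injective _≡_ _≡_ (List.lookup xs)
unique⇒lookup-injective (_ ∷ _)   {zero}  {zero}  _  = refl
unique⇒lookup-injective (x∉ ∷ _)  {zero}  {suc j} eq = contradiction eq (All.lookup x∉ (∈-lookup j))
unique⇒lookup-injective (x∉ ∷ _)  {suc i} {zero}  eq =
  contradiction (sym eq) (All.lookup x∉ (∈-lookup i))
unique⇒lookup-injective (_ ∷ uxs) {suc i} {suc j} eq = cong suc (unique⇒lookup-injective uxs eq)

-- Leaves and vertices of degree two.

-- A leaf with its neighbour, without reference to `degree`: this form passes easily between `T` and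
-- `T ∖ x`.
Pendant : Graph n → Fin n → Fin n → Set
Pendant G u a = Adj G u a × (∀ {z} → Adj G u z → a ≡ z)

TwinFree : Graph n → Set
TwinFree G = ∀ {u v a} → Pendant G u a → Pendant G v a → u ≡ v

module _ (G : Graph n) where

  adj⇒≢ : ∀ {u v} → Adj G u v → u ≢ v
  adj⇒≢ uv eq = Adj-irrefl G eq uv

  pendant⁺ : ∀ {u} (u∈𝓛 : u ∈ 𝓛 G) → Pendant G u (G ⟨ u∈𝓛 ⟩⁺)
  pendant⁺ u∈𝓛 = proj₂ (leaf-neighbour G u∈𝓛)

  pendant⇒leaf : ∀ {u a} → Pendant G u a → u ∈ 𝓛 G
  pendant⇒leaf {u} {a} (ua , only) = from (∈⟪⟫ (degree≟1 G)) (enumerates⇒∣p∣≡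
    {e = λ (_ : Fin 1) → a}
    ( (λ { {zero} {zero} _ → refl })
    , mk⇔ (λ v∈N → zero , only (to (∈⟪⟫ (adj? G u)) v∈N))
          (λ { (_ , refl) → from (∈⟪⟫ (adj? G u)) ua })))

  degree≡2⁺ : ∀ {u a b} → Adj G u a → Adj G u b → a ≢ b →
    (∀ {z} → Adj G u z → a ≡ z ⊎ b ≡ z) → degree G u ≡ 2
  degree≡2⁺ {u} {a} {b} ua ub a≢b only = enumerates⇒∣p∣≡
    {e = List.lookup (a ∷ b ∷ [])}
    ( unique⇒lookup-injective ((a≢b ∷ []) ∷ [] ∷ [])
    , mk⇔ (λ v∈N → [ (zero ,_) , (suc zero ,_) ]′ (only (to (∈⟪⟫ (adj? G u)) v∈N)))
          (λ { (zero , refl) → from (∈⟪⟫ (adj? G u)) ua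
             ; (suc zero , refl) → from (∈⟪⟫ (adj? G u)) ub }))

  degree≡2⁻ : ∀ {u a b z} → degree G u ≡ 2 → Adj G u a → Adj G u b → a ≢ b →
    Adj G u z → a ≡ z ⊎ b ≡ z
  degree≡2⁻ {u} {a} {b} {z} deg ua ub a≢b uz with a ≟ z | b ≟ z
  ... | yes a≡z | _       = inj₁ a≡z
  ... | no _    | yes b≡z = inj₂ b≡z
  ... | no a≢z  | no b≢z  = contradiction
    (≤-trans (cover⇒≤ (proj₁ (enumerate (neighbours G u)))
                      (unique⇒lookup-injective ((a≢b ∷ a≢z ∷ []) ∷ (b≢z ∷ []) ∷ [] ∷ []))
                      λ i → to (proj₂ (proj₂ (enumerate (neighbours G u)))) (neighbour i))
             (≤-reflexive deg))
    1+n≰n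
    where
    neighbour : ∀ i → List.lookup (a ∷ b ∷ z ∷ []) i ∈ neighbours G u
    neighbour zero             = from (∈⟪⟫ (adj? G u)) ua
    neighbour (suc zero)       = from (∈⟪⟫ (adj? G u)) ub
    neighbour (suc (suc zero)) = from (∈⟪⟫ (adj? G u)) uz

  pendant-or-branching : ∀ {u a} → Adj G u a → Pendant G u a ⊎ ∃ λ b → Adj G u b × a ≢ b
  pendant-or-branching {u} {a} ua with any? (λ b → adj? G u b ×-dec ¬? (a ≟ b))
  ... | yes branch = inj₂ branch
  ... | no ¬branch = inj₁ (ua , λ uz → decidable-stable (a ≟ _) λ a≢z → ¬branch (_ , uz , a≢z))

-- Paths and acyclicity.

module _ {G : Graph n} where

  suffix : ∀ {u v t} (p : Path G u v) → t ∈ˡ vertices (walk p) → Path G t v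
  suffix p@(path ε _)        (here refl)  = p
  suffix p@(path (_ ◅ _) _)  (here refl)  = p
  suffix (path (_ ◅ w) (_ ∷ uw)) (there t∈) = suffix (path w uw) t∈

  prefix : ∀ {u v t} (p : Path G u v) → t ∈ˡ vertices (walk p) →
    ∃ λ (q : Path G u t) → vertices (walk q) List⊆.⊆ vertices (walk p)
  prefix p@(path ε _)       (here refl) = p , id
  prefix (path (_ ◅ _) _)   (here refl) = path ε ([] ∷ []) , λ { (here eq) → here eq }
  prefix (path (a ◅ w) (u∉ ∷ uw)) (there t∈) with prefix (path w uw) t∈
  ... | path w′ uw′ , w′⊆w = path (a ◅ w′) (anti-mono w′⊆w u∉ ∷ uw′) ,
    λ { (here eq) → here eq ; (there z∈) → there (w′⊆w z∈) }

  extend : ∀ {u v t} → Adj G t u → (p : Path G u v) → t ∉ˡ vertices (walk p) → Path G t v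
  extend a (path w uw) t∉ = path (a ◅ w) (¬Any⇒All¬ _ t∉ ∷ uw)

  -- Loop erasure: if the start recurs in the simplified rest, everything before that recurrence is
  -- dropped.
  simplify : ∀ {u v} → Star (Adj G) u v → Path G u v
  simplify ε = path ε ([] ∷ [])
  simplify {u} (a ◅ w) with simplify w
  ... | p with ∈ˡ? _≟_ u (vertices (walk p))
  ...   | yes u∈ = suffix p u∈
  ...   | no  u∉ = extend a p u∉

  -- Otherwise putting `c` in front of `p` gives a path from `c` to `b` that the edge `bc` closes to
  -- a cycle; `a ≢ b` ensures that it has two edges. All uses of acyclicity go through this lemma.
  acyclic-detour : Acyclic G → ∀ {a b c} → Adj G b c → Adj G c a → a ≢ b →
    (p : Path G a b) → c ∈ˡ vertices (walk p)
  acyclic-detour acyclic {c = c} bc ca a≢b p with ∈ˡ? _≟_ c (vertices (walk p))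
  ... | yes c∈ = c∈
  ... | no  c∉ = contradiction bc (acyclic (extend ca p c∉) (s≤s (positive p)))
    where
    positive : (p : Path G _ _) → 1 ≤ length p
    positive (path ε _)       = contradiction refl a≢b
    positive (path (_ ◅ _) _) = s≤s z≤n

-- Connectedness by cuts, and short cycles.

-- Connectedness phrased by cuts instead of paths, because a cut of `T ∖ x` can be pulled back to
-- `T` along `retract`.
CutConnected : Graph n → Set₁
CutConnected {n} G = {P : Pred (Fin n) 0ℓ} → Decidable P → ∀ {a b} → P a → ¬ P b →
  ∃₂ λ u v → P u × ¬ P v × Adj G u v

record Treelike (G : Graph n) : Set₁ where
  field
    cut         : CutConnected G
    no-triangle : ∀ {a b c} → Adj G a b → Adj G b c → ¬ Adj G c a
    no-square   : ∀ {a b c d} → a ≢ b → Adj G a c → Adj G b c → Adj G a d → Adj G b d → c ≡ d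

open Treelike

connected⇒cutConnected : {G : Graph n} → Connected G → CutConnected G
connected⇒cutConnected {G = G} conn {P} P? {a} {b} pa ¬pb = go (walk (conn a b)) pa
  where
  go : ∀ {a} → Star (Adj G) a b → P a → ∃₂ λ u v → P u × ¬ P v × Adj G u v
  go ε pa = contradiction pa ¬pb
  go (_◅_ {j = c} ac w) pa with P? c
  ... | yes pc = go w pc
  ... | no ¬pc = _ , _ , pa , ¬pc , ac

-- Both times `a` and `b` are neighbours of `c`, so the path from `a` to `b`, direct or via `d`,
-- must contain `c`; irreflexivity leaves only `c ≡ d`.
tree⇒treelike : {G : Graph n} → IsTree G → Treelike G
tree⇒treelike {G = G} tree = record
  { cut         = connected⇒cutConnected connected
  ; no-triangle = no-triangle′
  ; no-square   = no-square′
  }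
  where
  open IsTree tree

  no-triangle′ : ∀ {a b c} → Adj G a b → Adj G b c → ¬ Adj G c a
  no-triangle′ ab bc ca
    with acyclic-detour acyclic bc ca (adj⇒≢ G ab) (path (ab ◅ ε) ((adj⇒≢ G ab ∷ []) ∷ [] ∷ []))
  ... | here refl         = Adj-irrefl G refl ca
  ... | there (here refl) = Adj-irrefl G refl bc

  no-square′ : ∀ {a b c d} → a ≢ b → Adj G a c → Adj G b c → Adj G a d → Adj G b d → c ≡ d
  no-square′ {a} {b} {c} {d} a≢b ac bc ad bd
    with acyclic-detour acyclic bc (Adj-sym G ac) a≢b
           (path (ad ◅ Adj-sym G bd ◅ ε)
                 ((adj⇒≢ G ad ∷ a≢b ∷ []) ∷ (≢-sym (adj⇒≢ G bd) ∷ []) ∷ [] ∷ []))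
  ... | here refl                 = contradiction ac (Adj-irrefl G refl)
  ... | there (here refl)         = refl
  ... | there (there (here refl)) = contradiction bc (Adj-irrefl G refl)

-- A proper nonempty set of vertices has an edge leaving it, so a set closed under adjacency is V.
closed⇒n≤ : {G : Graph n} → CutConnected G → (f : Fin (suc k) → Fin n) →
  (∀ i {z} → Adj G (f i) z → ∃ λ j → f j ≡ z) → n ≤ suc k
closed⇒n≤ {G = G} cut f closed = cover⇒≤ f id covered
  where
  covered : ∀ v → ∃ λ i → f i ≡ v
  covered v = decidable-stable (range? f v) λ v∉ →
    let _ , z , (i , fi≡u) , z∉ , uz = cut (range? f) (zero , refl) v∉
    in z∉ (closed i (subst (λ u → Adj G u z) (sym fi≡u) uz))

has-neighbour : {G : Graph n} → CutConnected G → 2 ≤ n → ∀ u → ∃ (Adj G u)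
has-neighbour {suc zero}    _   (s≤s ()) _
has-neighbour {suc (suc _)} {G} cut _ u =
  -- `punchIn u zero` serves as a vertex other than `u`.
  let _ , v , u≡w , _ , wv = cut (u ≟_) refl (≢-sym (punchInᵢ≢i u zero))
  in v , subst (λ u → Adj G u v) (sym u≡w) wv

-- Modules, twins and components.

module _ {G : Graph n} where

  -- The pair `u`, `v` is a module: `a` is adjacent to both and no other vertex to either. It is not
  -- the whole vertex set because `a` lies outside.
  indecomposable⇒twinFree : Indecomposable G → TwinFree G
  indecomposable⇒twinFree indec {u} {v} {a} (ua , only-u) (va , only-v) =
    decidable-stable (u ≟ v) λ u≢v → nontrivial u≢v (indec M module-M)
    where
    M = ⁅ u ⁆ ∪ ⁅ v ⁆

    u∈M : u ∈ M
    u∈M = x∈p∪q⁺ (inj₁ (x∈⁅x⁆ u))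

    v∈M : v ∈ M
    v∈M = x∈p∪q⁺ {p = ⁅ u ⁆} (inj₂ (x∈⁅x⁆ v))

    elements : ∀ {z} → z ∈ M → z ≡ u ⊎ z ≡ v
    elements z∈ with x∈p∪q⁻ ⁅ u ⁆ ⁅ v ⁆ z∈
    ... | inj₁ z∈u = inj₁ (x∈⁅y⁆⇒x≡y u z∈u)
    ... | inj₂ z∈v = inj₂ (x∈⁅y⁆⇒x≡y v z∈v)

    module-M : IsModule G M
    module-M z _ with a ≟ z
    ... | yes refl = inj₁ λ t t∈ →
      [ (λ { refl → Adj-sym G ua }) , (λ { refl → Adj-sym G va }) ]′ (elements t∈)
    ... | no a≢z   = inj₂ λ t t∈ zt →
      [ (λ { refl → a≢z (only-u (Adj-sym G zt)) })
      , (λ { refl → a≢z (only-v (Adj-sym G zt)) }) ]′ (elements t∈)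

    nontrivial : u ≢ v → ¬ IsTrivial M
    nontrivial u≢v (inj₁ M≡⊥) = ∉⊥ (subst (u ∈_) M≡⊥ u∈M)
    nontrivial u≢v (inj₂ (inj₁ (c , M≡c))) =
      u≢v (trans (x∈⁅y⁆⇒x≡y c (subst (u ∈_) M≡c u∈M)) (sym (x∈⁅y⁆⇒x≡y c (subst (v ∈_) M≡c v∈M))))
    nontrivial u≢v (inj₂ (inj₂ M≡⊤)) =
      [ (λ { refl → Adj-irrefl G refl ua }) , (λ { refl → Adj-irrefl G refl va }) ]′
        (elements (subst (a ∈_) (sym M≡⊤) ∈⊤))

  -- Some v outside a nonempty proper module M is adjacent to all of M.  Acyclicity makes M
  -- independent with no other outside neighbour, so the vertices of M are pendant at v.
  twinFree⇒indecomposable : Treelike G → TwinFree G → Indecomposable G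
  twinFree⇒indecomposable tl twinfree M mod with nonempty? M
  ... | no empty = inj₁ (Empty-unique empty)
  ... | yes (m , m∈M) with all? (_∈? M)
  ...   | yes full = inj₂ (inj₂ (⊆-antisym (λ _ → ∈⊤) (λ _ → full _)))
  ...   | no ¬full = inj₂ (inj₁ (m ,
    ⊆-antisym singleton λ z∈ → subst (_∈ M) (sym (x∈⁅y⁆⇒x≡y m z∈)) m∈M))
    where
    outer : ∃ λ v → v ∉ M × (∀ u → u ∈ M → Adj G v u)
    outer with any? (λ b → ¬? (b ∈? M))
    ... | no ¬out = contradiction (λ b → decidable-stable (b ∈? M) λ b∉ → ¬out (b , b∉)) ¬full
    ... | yes (b , b∉M) with cut tl (_∈? M) m∈M b∉M
    ...   | u , v , u∈M , v∉M , uv with mod v v∉M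
    ...     | inj₁ all  = v , v∉M , all
    ...     | inj₂ none = contradiction (Adj-sym G uv) (none u u∈M)

    singleton : ∀ {z} → z ∈ M → z ∈ ⁅ m ⁆
    singleton {z} z∈M with m ≟ z | outer
    ... | yes refl | _ = x∈⁅x⁆ m
    ... | no m≢z   | v , v∉M , v~ = contradiction
            (twinfree (pendant m∈M z∈M m≢z) (pendant z∈M m∈M (≢-sym m≢z))) m≢z
      where
      pendant : ∀ {s t} → s ∈ M → t ∈ M → s ≢ t → Pendant G s v
      pendant {s} {t} s∈M t∈M s≢t = Adj-sym G (v~ s s∈M) , only
        where
        only : ∀ {z} → Adj G s z → v ≡ z
        only {z} sz with z ∈? M
        ... | yes z∈M = contradiction (v~ s s∈M) (no-triangle tl sz (Adj-sym G (v~ z z∈M)))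
        ... | no z∉M with mod z z∉M
        ...   | inj₁ all  = no-square tl s≢t (Adj-sym G (v~ s s∈M)) (Adj-sym G (v~ t t∈M))
                              sz (Adj-sym G (all t t∈M))
        ...   | inj₂ none = contradiction (Adj-sym G sz) (none s s∈M)

  separated-module : (P : Subset n) → (∀ {u v} → u ∈ P → v ∉ P → ¬ Adj G u v) →
    IsModule G P × IsModule G (∁ P)
  separated-module P sep =
    (λ v v∉ → inj₂ λ u u∈ vu → sep u∈ v∉ (Adj-sym G vu)) ,
    (λ v v∉ → inj₂ λ u u∈ vu → sep (x∉∁p⇒x∈p v∉) (x∈∁p⇒x∉p u∈) vu)

  -- Reachability is not known to be decidable at this point, hence the double negation.
  indecomposable⇒¬¬connected : Indecomposable G → 3 ≤ n → ∀ a b → ¬ ¬ Star (Adj G) a b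
  indecomposable⇒¬¬connected indec 3≤n a b a≁b =
    sequence (RawMonad.rawApplicative ¬¬-Monad) {P = λ u → Dec (Star (Adj G) a u)}
      (λ _ → ¬¬-excluded-middle) λ reach? → decided reach?
    where
    decided : ¬ Decidable (Star (Adj G) a)
    -- The component `P` of `a` and its complement are nonempty proper modules, hence singletons,
    -- which leaves only two vertices.
    decided reach? = contradiction (≤-trans 3≤n (cover⇒≤ (lookup (c ∷ d ∷ [])) id covered)) 1+n≰n
      where
      P = ⟪ reach? ⟫

      a∈P : a ∈ P
      a∈P = from (∈⟪⟫ reach?) ε

      b∉P : b ∉ P
      b∉P = a≁b ∘ to (∈⟪⟫ reach?)

      modules = separated-module P λ u∈ v∉ uv →
        v∉ (from (∈⟪⟫ reach?) (to (∈⟪⟫ reach?) u∈ ◅◅ uv ◅ ε))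

      singleton : (Q : Subset n) → IsModule G Q → ∀ {s t} → s ∈ Q → t ∉ Q →
        ∃ λ c → ∀ {v} → v ∈ Q → c ≡ v
      singleton Q mod s∈ t∉ with indec Q mod
      ... | inj₁ refl              = contradiction s∈ ∉⊥
      ... | inj₂ (inj₁ (c , refl)) = c , sym ∘ x∈⁅y⁆⇒x≡y c
      ... | inj₂ (inj₂ refl)       = contradiction ∈⊤ t∉

      c,is-c = singleton P (proj₁ modules) a∈P b∉P
      d,is-d = singleton (∁ P) (proj₂ modules) (x∉p⇒x∈∁p b∉P) (x∈p⇒x∉∁p a∈P)
      c = proj₁ c,is-c
      d = proj₁ d,is-d

      covered : ∀ v → ∃ λ i → lookup (c ∷ d ∷ []) i ≡ v
      covered v with v ∈? P
      ... | yes v∈ = zero , proj₂ c,is-c v∈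
      ... | no  v∉ = suc zero , proj₂ d,is-d (x∉p⇒x∈∁p v∉)

-- Deleting a vertex.

vertices-gmap : {A B : Set} {R : Rel A 0ℓ} {S : Rel B 0ℓ} (f : A → B)
  (g : ∀ {u v} → R u v → S (f u) (f v)) → ∀ {u v} (w : Star R u v) →
  vertices (gmap {U = S} f g w) ≡ List.map f (vertices w)
vertices-gmap f g ε       = refl
vertices-gmap f g (_ ◅ w) = cong (_ ∷_) (vertices-gmap f g w)

module _ (T : Graph (suc m)) (x : Fin (suc m)) where

  lift-path : ∀ {u v} → Path (T ∖ x) u v → Path T (punchIn x u) (punchIn x v)
  lift-path (path w uw) = path (gmap (punchIn x) id w)
    (subst Unique (sym (vertices-gmap (punchIn x) id w))
           (Uniqueₚ.map⁺ (punchIn-injective x _ _) uw))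

  lift-path-avoids : ∀ {u v} (p : Path (T ∖ x) u v) → x ∉ˡ vertices (walk (lift-path p))
  lift-path-avoids (path w _) x∈
    with ∈-map⁻ (punchIn x) (subst (x ∈ˡ_) (vertices-gmap (punchIn x) id w) x∈)
  ... | v , _ , x≡ = punchInᵢ≢i x v (sym x≡)

  -- Were `T ∖ x` indecomposable, a path in it would join `a` to `b`; lifted to `T` it avoids `x`,
  -- contrary to `acyclic-detour`.
  branching⇒critical : 3 ≤ m → Acyclic T → ∀ {a b} → Adj T x a → Adj T x b → a ≢ b → Critical T x
  branching⇒critical 3≤m acyclic {a} {b} xa xb a≢b indec =
    indecomposable⇒¬¬connected {G = T ∖ x} indec 3≤m (punchOut (adj⇒≢ T xa)) (punchOut (adj⇒≢ T xb))
      λ w → let p = simplify {G = T ∖ x} w in lift-path-avoids p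
        (acyclic-detour acyclic
          (subst (λ b → Adj T b x) (sym b≡) (Adj-sym T xb))
          (subst (Adj T x) (sym a≡) xa)
          (λ eq → a≢b (trans (sym a≡) (trans eq b≡)))
          (lift-path p))
    where
    a≡ = punchIn-punchOut (adj⇒≢ T xa)
    b≡ = punchIn-punchOut (adj⇒≢ T xb)

  module _ {p} (pendant : Pendant T x p) where

    private
      xp = proj₁ pendant

    retract : Fin (suc m) → Fin m
    retract v with x ≟ v
    ... | yes _  = punchOut (adj⇒≢ T xp)
    ... | no x≢v = punchOut x≢v

    retract-punchIn : ∀ v → retract (punchIn x v) ≡ v
    retract-punchIn v with x ≟ punchIn x v
    ... | yes x≡ = contradiction (sym x≡) (punchInᵢ≢i x v)
    ... | no x≢  = trans (punchOut-cong x refl) (punchOut-punchIn x)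

    -- Collapsing x onto its only neighbour p is a weak graph homomorphism T → T ∖ x.
    retract-adj : ∀ {u v} → Adj T u v → retract u ≡ retract v ⊎ Adj (T ∖ x) (retract u) (retract v)
    retract-adj {u} {v} uv with x ≟ u | x ≟ v
    ... | yes refl | yes refl = inj₁ refl
    ... | yes refl | no x≢v   = inj₁ (punchOut-cong x (proj₂ pendant uv))
    ... | no x≢u   | yes refl = inj₁ (punchOut-cong x (sym (proj₂ pendant (Adj-sym T uv))))
    ... | no x≢u   | no x≢v   = inj₂
      (subst₂ (Adj T) (sym (punchIn-punchOut x≢u)) (sym (punchIn-punchOut x≢v)) uv)

    treelike-∖ : Treelike T → Treelike (T ∖ x)
    treelike-∖ tl = record
      { cut         = cut′
      ; no-triangle = no-triangle tl
      ; no-square   = λ a≢b ac bc ad bd → punchIn-injective x _ _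
          (no-square tl (a≢b ∘ punchIn-injective x _ _) ac bc ad bd)
      }
      where
      cut′ : CutConnected (T ∖ x)
      -- An edge of `T` that crosses the pulled back cut cannot collapse, since its ends retract to
      -- different sides.
      cut′ {P} P? {a} {b} pa ¬pb
        with cut tl {P = P ∘ retract} (P? ∘ retract)
               (subst P (sym (retract-punchIn a)) pa) (¬pb ∘ subst P (retract-punchIn b))
      ... | u , v , pu , ¬pv , uv with retract-adj uv
      ...   | inj₁ eq  = contradiction (subst P eq pu) ¬pv
      ...   | inj₂ uv′ = _ , _ , pu , ¬pv , uv′

    pendant-∖⁺ : ∀ {u a} → Pendant T (punchIn x u) (punchIn x a) → Pendant (T ∖ x) u a
    pendant-∖⁺ (ua , only) = ua , punchIn-injective x _ _ ∘ only

    pendant-∖⁻ : ∀ {u a} → Pendant (T ∖ x) u a →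
      ∀ {z} → Adj T (punchIn x u) z → x ≡ z ⊎ punchIn x a ≡ z
    pendant-∖⁻ {u} {a} (ua , only) {z} uz with x ≟ z
    ... | yes x≡z = inj₁ x≡z
    ... | no x≢z  = inj₂ (trans
      (cong (punchIn x) (only (subst (Adj T (punchIn x u)) (sym (punchIn-punchOut x≢z)) uz)))
      (punchIn-punchOut x≢z))

    -- Only `p` loses a neighbour with `x`, so every other leaf of `T ∖ x` is already a leaf of `T`.
    pendant-∖⇒pendant : ∀ {u a} → p ≢ punchIn x u → Pendant (T ∖ x) u a →
      Pendant T (punchIn x u) (punchIn x a)
    pendant-∖⇒pendant {u} p≢u pend = proj₁ pend , λ uz → [ not-x uz , id ]′ (pendant-∖⁻ pend uz)
      where
      not-x : ∀ {z} → Adj T (punchIn x u) z → x ≡ z → _ ≡ z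
      not-x uz refl = contradiction (proj₂ pendant (Adj-sym T uz)) p≢u

-- Distances between leaves.

module _ {G : Graph n} (conn : Connected G) where

  dist≤length : ∀ {u v} (p : Path G u v) → dist G conn u v ≤ length p
  dist≤length {u} {v} = proj₂ (shortestPath G conn u v)

  LeavesFar : Set
  LeavesFar = ∀ y z → y ∈ 𝓛 G → z ∈ 𝓛 G → y ≢ z → dist G conn y z ≥ 3

  leavesFar⇒twinFree : LeavesFar → TwinFree G
  leavesFar⇒twinFree far {u} {v} {a} pu@(ua , _) pv@(va , _) = decidable-stable (u ≟ v) λ u≢v →
    1+n≰n (≤-trans (far u v (pendant⇒leaf G pu) (pendant⇒leaf G pv) u≢v)
      (dist≤length (path (ua ◅ Adj-sym G va ◅ ε)
        ((adj⇒≢ G ua ∷ u≢v ∷ []) ∷ (≢-sym (adj⇒≢ G va) ∷ []) ∷ [] ∷ []))))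

  -- Two adjacent leaves form a component by themselves, so they would be the whole graph.
  leaves-nonadjacent : 3 ≤ n → ∀ {y z} → y ∈ 𝓛 G → z ∈ 𝓛 G → ¬ Adj G y z
  leaves-nonadjacent 3≤n {y} {z} y∈𝓛 z∈𝓛 yz = 1+n≰n (≤-trans 3≤n
    (closed⇒n≤ {G = G} (connected⇒cutConnected conn) (lookup (y ∷ z ∷ [])) λ
      { zero       yt → suc zero , trans (sym (only-y yz)) (only-y yt)
      ; (suc zero) zt → zero , trans (sym (only-z (Adj-sym G yz))) (only-z zt) }))
    where
    only-y = λ {t} → proj₂ (pendant⁺ G y∈𝓛) {t}
    only-z = λ {t} → proj₂ (pendant⁺ G z∈𝓛) {t}

  twinFree⇒leavesFar : 3 ≤ n → TwinFree G → LeavesFar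
  twinFree⇒leavesFar 3≤n twinfree y z y∈𝓛 z∈𝓛 y≢z with proj₁ (shortestPath G conn y z)
  ... | path ε _               = contradiction refl y≢z
  ... | path (yz ◅ ε) _        = contradiction yz (leaves-nonadjacent 3≤n y∈𝓛 z∈𝓛)
  ... | path (ya ◅ az ◅ ε) _   = contradiction (twinfree py (subst (Pendant G z) q≡p pz)) y≢z
    where
    py = pendant⁺ G y∈𝓛
    pz = pendant⁺ G z∈𝓛
    q≡p = trans (proj₂ pz (Adj-sym G az)) (sym (proj₂ py ya))
  ... | path (_ ◅ _ ◅ _ ◅ _) _ = s≤s (s≤s (s≤s z≤n))

  -- The inner vertices of a path of length three between leaves are `p` and `q`; its simplicity
  -- gives the two inequalities.
  dist≡3⇒ : ∀ {y z p q} → Pendant G y p → Pendant G z q → dist G conn y z ≡ 3 →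
    Adj G p q × y ≢ q × p ≢ z
  dist≡3⇒ {y} {z} (_ , only-y) (_ , only-z) eq with proj₁ (shortestPath G conn y z)
  dist≡3⇒ _ _ () | path ε _
  dist≡3⇒ _ _ () | path (_ ◅ ε) _
  dist≡3⇒ _ _ () | path (_ ◅ _ ◅ ε) _
  dist≡3⇒ _ _ () | path (_ ◅ _ ◅ _ ◅ _ ◅ _) _
  dist≡3⇒ {y} {z} (_ , only-y) (_ , only-z) eq
    | path (ya ◅ ab ◅ bz ◅ ε) ((_ ∷ y≢b ∷ _) ∷ (_ ∷ a≢z ∷ _) ∷ _)
    with only-y ya | only-z (Adj-sym G bz)
  ... | refl | refl = ab , y≢b , a≢z

  -- For a leaf `x` at `p`: deleting `x` leaves `p` with one neighbour, to which the leaf `y` is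
  -- attached too, so `p` and `y` become twins.
  Blocked : (x p : Fin n) → Set
  Blocked x p = degree G p ≡ 2 × ∃ λ y → y ∈ 𝓛 G × dist G conn x y ≡ 3

  blocked? : ∀ x p → Dec (Blocked x p)
  blocked? x p = (degree G p ℕ.≟ 2) ×-dec any? λ y → (y ∈? 𝓛 G) ×-dec (dist G conn x y ℕ.≟ 3)

  -- Both leaves hang on the neighbour of p other than x.
  blocking-leaf-unique : TwinFree G → ∀ {x p y z} → Pendant G x p → degree G p ≡ 2 →
    y ∈ 𝓛 G → z ∈ 𝓛 G → dist G conn x y ≡ 3 → dist G conn x z ≡ 3 → y ≡ z
  blocking-leaf-unique twinfree {x} {p} {y} {z} px@(xp , _) deg y∈𝓛 z∈𝓛 δy δz
    with dist≡3⇒ px (pendant⁺ G y∈𝓛) δy | dist≡3⇒ px (pendant⁺ G z∈𝓛) δz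
  ... | pq , x≢q , _ | pr , x≢r , _ with degree≡2⁻ G deg (Adj-sym G xp) pq x≢q pr
  ... | inj₁ x≡r = contradiction x≡r x≢r
  ... | inj₂ q≡r = twinfree (pendant⁺ G y∈𝓛) (subst (Pendant G z) (sym q≡r) (pendant⁺ G z∈𝓛))

-- Critical leaves.

module _ {T : Graph (suc m)} (conn : Connected T) where

  -- In an indecomposable `T ∖ x` the new twins `p` and `y` would coincide, but on a shortest path
  -- from `x` to `y` they are distinct.
  blocked⇒critical : ∀ {x p} → Pendant T x p → Blocked conn x p → Critical T x
  blocked⇒critical {x} {p} px@(xp , _) (deg , y , y∈𝓛 , δ≡3) indec
    with dist≡3⇒ conn px (pendant⁺ T y∈𝓛) δ≡3
  ... | pq , x≢q , p≢y = p≢y (trans (sym p≡) (trans (cong (punchIn x) twins) y≡))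
    where
    q = T ⟨ y∈𝓛 ⟩⁺

    -- If `y` were `x`, then `q` would be `p`, yet they are adjacent.
    x≢y : x ≢ y
    x≢y refl = Adj-irrefl T (proj₂ px (proj₁ (pendant⁺ T y∈𝓛))) pq

    p≡ = punchIn-punchOut (adj⇒≢ T xp)
    q≡ = punchIn-punchOut x≢q
    y≡ = punchIn-punchOut x≢y

    only : ∀ {z} → Adj T p (punchIn x z) → punchOut x≢q ≡ z
    only {z} pz with degree≡2⁻ T deg (Adj-sym T xp) pq x≢q pz
    ... | inj₁ x≡z = contradiction (sym x≡z) (punchInᵢ≢i x z)
    ... | inj₂ q≡z = punchIn-injective x _ _ (trans q≡ q≡z)

    twins = indecomposable⇒twinFree {G = T ∖ x} indec
      ( subst₂ (Adj T) (sym p≡) (sym q≡) pq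
      , λ pz → only (subst (λ p → Adj T p _) p≡ pz))
      (pendant-∖⁺ T x px (subst₂ (Pendant T) (sym y≡) (sym q≡) (pendant⁺ T y∈𝓛)))

  -- Contrapositive: `T ∖ x` is again treelike, so its decomposability requires twins; as `T` has
  -- none, one of them is `p`.
  critical⇒blocked : 2 ≤ m → Treelike T → TwinFree T → ∀ {x p} → Pendant T x p →
    Critical T x → Blocked conn x p
  critical⇒blocked 2≤m tl twinfree {x} {p} px@(xp , only-x) crit = decidable-stable (blocked? conn x p)
    λ ¬blocked → crit (twinFree⇒indecomposable {G = T ∖ x} (treelike-∖ T x px tl)
      λ {u} {v} {a} pu pv → decidable-stable (u ≟ v) λ u≢v → twins ¬blocked pu pv u≢v)
    where
    far = twinFree⇒leavesFar conn (s≤s 2≤m) twinfree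

    -- One twin is `p`, with neighbours `x` and `a`; the other, `v`, is a leaf of `T` at `a`. The
    -- path `x`, `p`, `a`, `v` bounds the distance by 3 from above, and `far` bounds it from below.
    twin⇒blocked : ∀ {u v a} → p ≡ punchIn x u → p ≢ punchIn x v →
      Pendant (T ∖ x) u a → Pendant (T ∖ x) v a → Blocked conn x p
    twin⇒blocked {u} {v} {a} refl p≢v pu pv =
      degree≡2⁺ T (Adj-sym T xp) (proj₁ pu) (≢-sym (punchInᵢ≢i x a))
        (pendant-∖⁻ T x px pu) ,
      punchIn x v , v∈𝓛 ,
      ≤-antisym
        (dist≤length conn (path (xp ◅ proj₁ pu ◅ Adj-sym T (proj₁ pv) ◅ ε)
          ( (adj⇒≢ T xp ∷ ≢-sym (punchInᵢ≢i x a) ∷ x≢v ∷ [])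
          ∷ (adj⇒≢ T (proj₁ pu) ∷ p≢v ∷ [])
          ∷ (≢-sym (adj⇒≢ T (proj₁ pv)) ∷ []) ∷ [] ∷ [])))
        (far x (punchIn x v) (pendant⇒leaf T px) v∈𝓛 x≢v)
      where
      x≢v = ≢-sym (punchInᵢ≢i x v)
      v∈𝓛 = pendant⇒leaf T (pendant-∖⇒pendant T x px p≢v pv)

    twins : ∀ {u v a} → ¬ Blocked conn x p → Pendant (T ∖ x) u a → Pendant (T ∖ x) v a → ¬ u ≢ v
    twins {u} {v} ¬blocked pu pv u≢v with p ≟ punchIn x u | p ≟ punchIn x v
    ... | yes p≡u | yes p≡v = u≢v (punchIn-injective x u v (trans (sym p≡u) p≡v))
    ... | yes p≡u | no p≢v  = ¬blocked (twin⇒blocked p≡u p≢v pu pv)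
    ... | no p≢u  | yes p≡v = ¬blocked (twin⇒blocked p≡v p≢u pv pu)
    ... | no p≢u  | no p≢v  = u≢v (punchIn-injective x u v
      (twinfree (pendant-∖⇒pendant T x px p≢u pu) (pendant-∖⇒pendant T x px p≢v pv)))

-- Existence of a leaf.

path-length< : {G : Graph n} → ∀ {u v} (p : Path G u v) → suc (length p) ≤ n
path-length< (path w uw) = ≤-trans (≤-reflexive (edges-vertices w))
  (injective⇒≤ (unique⇒lookup-injective uw))
  where
  edges-vertices : ∀ {u v} (w : Star _ u v) → suc (edges w) ≡ List.length (vertices w)
  edges-vertices ε       = refl
  edges-vertices (_ ◅ w) = cong suc (edges-vertices w)

-- Without leaves every path could be prolonged by a new vertex.
leaf-exists : {G : Graph n} → Acyclic G → CutConnected G → 2 ≤ n → ∃ (_∈ 𝓛 G)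
leaf-exists {suc n} {G} acyclic cut 2≤n = decidable-stable (any? (_∈? 𝓛 G)) λ ¬leaf →
  -- A path with as many edges as the graph has vertices has one vertex too many.
  let _ , _ , p , eq = long ¬leaf (suc n)
  in 1+n≰n (subst (λ l → suc l ≤ suc n) eq (path-length< p))
  where
  prolong : ¬ ∃ (_∈ 𝓛 G) → ∀ {u v} (p : Path G u v) → ∃ λ t → Adj G t u × t ∉ˡ vertices (walk p)
  prolong ¬leaf {u} (path ε _) =
    let a , ua = has-neighbour {G = G} cut 2≤n u
    in a , Adj-sym G ua , λ { (here a≡u) → Adj-irrefl G (sym a≡u) ua }
  prolong ¬leaf {u} p@(path (ua ◅ w) (u∉ ∷ uw)) with pendant-or-branching G ua
  ... | inj₁ pend            = contradiction (u , pendant⇒leaf G pend) ¬leaf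
  ... | inj₂ (b , ub , a≢b) = b , Adj-sym G ub , fresh
    where
    fresh : b ∉ˡ vertices (walk p)
    fresh (here refl) = Adj-irrefl G refl ub
    -- The part of `w` from `a` to `b` joins two neighbours of `u`, so it contains `u`, contrary to
    -- the simplicity of `p`.
    fresh (there b∈)  with prefix (path w uw) b∈
    ... | q , q⊆w = All¬⇒¬Any u∉ (q⊆w (acyclic-detour acyclic (Adj-sym G ub) ua a≢b q))

  long : ¬ ∃ (_∈ 𝓛 G) → ∀ l → ∃₂ λ u v → ∃ λ (p : Path G u v) → length p ≡ l
  long ¬leaf zero    = zero , zero , path ε ([] ∷ []) , refl
  long ¬leaf (suc l) =
    let _ , _ , p , eq = long ¬leaf l
        _ , a , t∉     = prolong ¬leaf p
    in _ , _ , extend a p t∉ , cong suc eq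

-- Trees with at least five vertices.

module _ {T : Graph (suc m)} (5≤n : 5 ≤ suc m) (tree : IsTree T) where

  open IsTree tree

  private
    tl : Treelike T
    tl = tree⇒treelike tree

    2≤n : 2 ≤ suc m
    2≤n = ≤-trans (s≤s (s≤s z≤n)) 5≤n

    3≤n : 3 ≤ suc m
    3≤n = ≤-trans (s≤s (s≤s (s≤s z≤n))) 5≤n

    3≤m : 3 ≤ m
    3≤m = ≤-trans (s≤s (s≤s (s≤s z≤n))) (s≤s⁻¹ 5≤n)

  nonCritical⇒leaf : ∀ {y} → NonCritical T y → y ∈ 𝓛 T
  nonCritical⇒leaf {y} nc with has-neighbour {G = T} (cut tl) 2≤n y
  ... | a , ya with pendant-or-branching T ya
  ...   | inj₁ pend           = pendant⇒leaf T pend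
  ...   | inj₂ (b , yb , a≢b) = contradiction (branching⇒critical T y 3≤m acyclic ya yb a≢b) nc

  leaf-critical⇒blocked : TwinFree T → ∀ {y p} → Pendant T y p → Critical T y →
    Blocked connected y p
  leaf-critical⇒blocked = critical⇒blocked connected (≤-trans (s≤s (s≤s z≤n)) 3≤m) tl

  -- If two leaves block each other, then T is the path on them and their neighbours, against n ≥ 5.
  blocking-leaf-nonCritical : TwinFree T → ∀ {y p z} → Pendant T y p → degree T p ≡ 2 →
    z ∈ 𝓛 T → dist T connected y z ≡ 3 → NonCritical T z
  blocking-leaf-nonCritical twinfree {y} {p} {z} py@(yp , only-y) deg z∈𝓛 δ≡3 crit-z
    with pendant⁺ T z∈𝓛 | leaf-critical⇒blocked twinfree (pendant⁺ T z∈𝓛) crit-z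
  ... | pz@(zq , only-z) | deg-q , _ with dist≡3⇒ connected py pz δ≡3
  ... | pq , y≢q , p≢z = 1+n≰n (≤-trans 5≤n
      (closed⇒n≤ {G = T} (cut tl) (lookup (y ∷ p ∷ q ∷ z ∷ [])) closed))
    where
    q = T ⟨ z∈𝓛 ⟩⁺

    closed : ∀ i {t} → Adj T (lookup (y ∷ p ∷ q ∷ z ∷ []) i) t →
      ∃ λ j → lookup (y ∷ p ∷ q ∷ z ∷ []) j ≡ t
    closed zero                   yt = suc zero , only-y yt
    closed (suc zero)             pt =
      [ (zero ,_) , (suc (suc zero) ,_) ]′ (degree≡2⁻ T deg (Adj-sym T yp) pq y≢q pt)
    closed (suc (suc zero))       qt =
      [ (suc zero ,_) , (suc (suc (suc zero)) ,_) ]′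
        (degree≡2⁻ T deg-q (Adj-sym T pq) (Adj-sym T zq) p≢z qt)
    closed (suc (suc (suc zero))) zt = suc (suc zero) , only-z zt

  -- Leaves are pairwise nonadjacent, so no `x⁺ j` is an `x i`; without twins `x⁺` is injective.
  leaves-≤-half : TwinFree T → {x : Fin k → Fin (suc m)} → Injective _≡_ _≡_ x →
    (∀ i → x i ∈ 𝓛 T) → k ≤ ⌊ suc m /2⌋
  leaves-≤-half {k} twinfree {x} inj leaf =
    -- Since `k` is half of `k + k`, it suffices to inject `Fin (k + k)` into the vertices.
    subst (_≤ _) (sym (n≡⌊n+n/2⌋ k)) (⌊n/2⌋-mono (injective⇒≤ {f = f ∘ splitAt k} λ {i} {j} eq →
      trans (sym (join-splitAt k k i))
        (trans (cong (join k k) (f-injective (splitAt k i) (splitAt k j) eq)) (join-splitAt k k j))))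
    where
    x⁺ : Fin k → Fin (suc m)
    x⁺ i = T ⟨ leaf i ⟩⁺

    f : Fin k ⊎ Fin k → Fin (suc m)
    f = [ x , x⁺ ]′

    x≢x⁺ : ∀ i j → x i ≢ x⁺ j
    x≢x⁺ i j eq = leaves-nonadjacent connected 3≤n (leaf j) (leaf i)
      (subst (Adj T (x j)) (sym eq) (proj₁ (pendant⁺ T (leaf j))))

    f-injective : ∀ s t → f s ≡ f t → s ≡ t
    f-injective (inj₁ i) (inj₁ j) eq = cong inj₁ (inj eq)
    f-injective (inj₁ i) (inj₂ j) eq = contradiction eq (x≢x⁺ i j)
    f-injective (inj₂ i) (inj₁ j) eq = contradiction (sym eq) (x≢x⁺ j i)
    f-injective (inj₂ i) (inj₂ j) eq = cong inj₂ (inj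
      (twinfree (pendant⁺ T (leaf i)) (subst (Pendant T (x j)) (sym eq) (pendant⁺ T (leaf j)))))

-- Equivalence of criticality with the four assertions.

theorem1p1 : (n : ℕ) → n ≥ 5 → (T : Graph n) → (tree : IsTree T) →
    (k : ℕ) → (x : Fin k → Fin n) → Injective _≡_ _≡_ x →
    let d = degree T
        δ = dist T (IsTree.connected tree)
    in
    ([- k ]-Critical T × σ T ≡ range x)
    ⇔
    ( (∀ y z → y ∈ 𝓛 T → z ∈ 𝓛 T → y ≢ z → δ y z ≥ 3)
    × (range x ⊆ 𝓛 T × 1 ≤ k × k ≤ ⌊ n /2⌋)
    × (∀ y → (y∈𝓛 : y ∈ 𝓛 T) → y ∉ range x →
         ∃! _≡_ (λ i → δ y (x i) ≡ 3 × d (T ⟨ y∈𝓛 ⟩⁺) ≡ 2))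
    × (∀ i → (xᵢ∈𝓛 : x i ∈ 𝓛 T) → d (T ⟨ xᵢ∈𝓛 ⟩⁺) ≡ 2 →
         ∀ y → y ∈ 𝓛 T → y ≢ x i → δ (x i) y ≥ 4))
theorem1p1 (suc m) n≥5 T tree k x inj = mk⇔ ⇒ ⇐
  where
  d = degree T
  conn = IsTree.connected tree
  δ = dist T conn

  Assertions : Set
  Assertions =
      (∀ y z → y ∈ 𝓛 T → z ∈ 𝓛 T → y ≢ z → δ y z ≥ 3)
    × (range x ⊆ 𝓛 T × 1 ≤ k × k ≤ ⌊ suc m /2⌋)
    × (∀ y → (y∈𝓛 : y ∈ 𝓛 T) → y ∉ range x →
         ∃! _≡_ (λ i → δ y (x i) ≡ 3 × d (T ⟨ y∈𝓛 ⟩⁺) ≡ 2))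
    × (∀ i → (xᵢ∈𝓛 : x i ∈ 𝓛 T) → d (T ⟨ xᵢ∈𝓛 ⟩⁺) ≡ 2 →
         ∀ y → y ∈ 𝓛 T → y ≢ x i → δ (x i) y ≥ 4)

  3≤n : 3 ≤ suc m
  3≤n = ≤-trans (s≤s (s≤s (s≤s z≤n))) n≥5

  x∈range : ∀ i → x i ∈ range x
  x∈range i = from (∈⟪⟫ (range? x)) (i , refl)

  ⇒ : [- k ]-Critical T × σ T ≡ range x → Assertions
  ⇒ (((indec , _) , _) , σ≡) =
    far , (range⊆𝓛 , 1≤k , leaves-≤-half n≥5 tree twinfree inj (range⊆𝓛 ∘ x∈range)) ,
    unique-blocker , unblocked
    where
    twinfree : TwinFree T
    twinfree = indecomposable⇒twinFree {G = T} indec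

    far : LeavesFar conn
    far = twinFree⇒leavesFar conn 3≤n twinfree

    ∈range⇒nonCritical : ∀ {y} → y ∈ range x → NonCritical T y
    ∈range⇒nonCritical {y} y∈ = to (∈⟪⟫ (nonCritical? T)) (subst (y ∈_) (sym σ≡) y∈)

    nonCritical⇒∈range : ∀ {y} → NonCritical T y → ∃ λ i → x i ≡ y
    nonCritical⇒∈range {y} nc = to (∈⟪⟫ (range? x)) (subst (y ∈_) σ≡ (from (∈⟪⟫ (nonCritical? T)) nc))

    range⊆𝓛 : range x ⊆ 𝓛 T
    range⊆𝓛 = nonCritical⇒leaf n≥5 tree ∘ ∈range⇒nonCritical

    -- The blocking leaf is non-critical, so it is some `x i`; any `x j` at distance three is a
    -- blocking leaf as well and hence the same one.
    unblocking : ∀ {y p} → Pendant T y p → Critical T y →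
      ∃! _≡_ (λ i → δ y (x i) ≡ 3 × d p ≡ 2)
    unblocking yp crit =
      let deg , z , z∈𝓛 , δ≡3 = leaf-critical⇒blocked n≥5 tree twinfree yp crit
          i , xᵢ≡z = nonCritical⇒∈range (blocking-leaf-nonCritical n≥5 tree twinfree yp deg z∈𝓛 δ≡3)
      in i , (trans (cong (δ _) xᵢ≡z) δ≡3 , deg) , λ (δ≡3′ , _) → inj (trans xᵢ≡z
           (blocking-leaf-unique conn twinfree yp deg z∈𝓛 (range⊆𝓛 (x∈range _)) δ≡3 δ≡3′))

    unique-blocker : ∀ y → (y∈𝓛 : y ∈ 𝓛 T) → y ∉ range x →
      ∃! _≡_ (λ i → δ y (x i) ≡ 3 × d (T ⟨ y∈𝓛 ⟩⁺) ≡ 2)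
    unique-blocker y y∈𝓛 y∉ = unblocking (pendant⁺ T y∈𝓛)
      (decidable-stable (critical? T y) (y∉ ∘ from (∈⟪⟫ (range? x)) ∘ nonCritical⇒∈range))

    1≤k : 1 ≤ k
    1≤k = inhabited index
      where
      inhabited : Fin k → 1 ≤ k
      inhabited zero    = s≤s z≤n
      inhabited (suc _) = s≤s z≤n

      index : Fin k
      -- Any leaf provides an index: it is some `x i` itself or is blocked by one.
      index with leaf-exists (IsTree.acyclic tree) (cut (tree⇒treelike tree))
                   (≤-trans (s≤s (s≤s z≤n)) 3≤n)
      ... | y , y∈𝓛 with y ∈? range x
      ...   | yes y∈ = proj₁ (to (∈⟪⟫ (range? x)) y∈)
      ...   | no y∉  = proj₁ (unique-blocker y y∈𝓛 y∉)

    unblocked : ∀ i → (xᵢ∈𝓛 : x i ∈ 𝓛 T) → d (T ⟨ xᵢ∈𝓛 ⟩⁺) ≡ 2 →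
      ∀ y → y ∈ 𝓛 T → y ≢ x i → δ (x i) y ≥ 4
    -- `far` gives at least 3, and equality would let `y` block `x i`, which is non-critical.
    unblocked i xᵢ∈𝓛 deg y y∈𝓛 y≢xᵢ = ≤∧≢⇒< (far (x i) y xᵢ∈𝓛 y∈𝓛 (≢-sym y≢xᵢ)) λ 3≡δ →
      ∈range⇒nonCritical (x∈range i)
        (blocked⇒critical conn (pendant⁺ T xᵢ∈𝓛) (deg , y , y∈𝓛 , sym 3≡δ))

  ⇐ : Assertions → [- k ]-Critical T × σ T ≡ range x
  ⇐ (far , (range⊆𝓛 , _ , _) , unique-blocker , unblocked) =
    ( ( twinFree⇒indecomposable (tree⇒treelike tree) twinfree
      , ≤-trans (s≤s (s≤s (s≤s (s≤s z≤n)))) n≥5)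
    , trans (cong ∣_∣ σ≡) (∣range∣ inj)) , σ≡
    where
    twinfree : TwinFree T
    twinfree = leavesFar⇒twinFree conn far

    σ⊆range : σ T ⊆ range x
    σ⊆range {y} y∈σ = decidable-stable (y ∈? range x) λ y∉ →
      -- A non-critical vertex is a leaf; outside the range, the third assertion would have it
      -- blocked by some `x i`.
      let nc  = to (∈⟪⟫ (nonCritical? T)) y∈σ
          y∈𝓛 = nonCritical⇒leaf n≥5 tree nc
          i , (δ≡3 , deg) , _ = unique-blocker y y∈𝓛 y∉
      in nc (blocked⇒critical conn (pendant⁺ T y∈𝓛) (deg , x i , range⊆𝓛 (x∈range i) , δ≡3))

    xᵢ-nonCritical : ∀ i → NonCritical T (x i)
    xᵢ-nonCritical i crit =
      -- A critical `x i` has a blocking leaf at distance 3, where the fourth assertion demands 4;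
      -- that leaf is not `x i`, whose distance to itself is 0.
      let xᵢ∈𝓛 = range⊆𝓛 (x∈range i)
          deg , y , y∈𝓛 , δ≡3 = leaf-critical⇒blocked n≥5 tree twinfree (pendant⁺ T xᵢ∈𝓛) crit
      in 1+n≰n (subst (4 ≤_) δ≡3 (unblocked i xᵢ∈𝓛 deg y y∈𝓛 λ y≡xᵢ →
           δxx≢3 (trans (cong (δ (x i)) (sym y≡xᵢ)) δ≡3)))
      where
      δxx≢3 : δ (x i) (x i) ≢ 3
      δxx≢3 eq = contradiction
        (≤-trans (≤-reflexive (sym eq)) (dist≤length conn (path ε ([] ∷ [])))) λ ()

    σ≡ : σ T ≡ range x
    σ≡ = ⊆-antisym σ⊆range λ y∈ → from (∈⟪⟫ (nonCritical? T))
      (subst (NonCritical T) (proj₂ (to (∈⟪⟫ (range? x)) y∈)) (xᵢ-nonCritical _))
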